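{- In the worst violated constraint model, there is an algorithm which, given oracle access to a hidden WIDESAT instance on $n$ variables and $m$ distinct clauses, where $m\le n$, learns an equivalent instance (i.e. outputs a SAT formula with exactly the same satisfying assignments in $\{0,1\}^n$ as the hidden one) in $O\!\left(\binom{n}{m-1}2^{m}+n\right)$ time.
   Context: A SAT formula on Boolean variables $x_1,\dots,x_n$ is a conjunction of clauses $C_1,\dots,C_m$, each a disjunction of literals ($x_i$ or $\overline{x}_i$) on pairwise distinct variables. A WIDESAT clause is a clause containing all $n$ distinct variables (each one either positively or negated); a WIDESAT instance is a formula all of whose clauses are WIDESAT clauses. Worst violated constraint model: the formula is hidden and is accessed only through an oracle. A query is a probabilistic assignment $\mathbf{a}:[n]\to[0,1]$, meaning that independently $\Pr[x_i=1]=\mathbf{a}(i)$ and $\Pr[\overline{x}_i=1]=1-\mathbf{a}(i)$. The violation probability of a clause $C_j$ with literal set $T(C_j)$ is $\Pr[C_j=0]=\prod_{\ell\in T(C_j)}\Pr[\ell=0]$. If all clauses have violation probability $0$, the oracle reports that the formula is satisfied; otherwise it returns the index $j$ of a clause with the highest violation probability, breaking ties arbitrarily (possibly adversarially). Running time is total running time, with each oracle query costing unit time. -}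

module Defs where

open import Data.Bool.Base using (Bool; true; false)
open import Data.Fin.Base using (Fin; toℕ; fromℕ<)
open import Data.Integer.Base as ℤ using (+_)
import Data.Integer.Properties as ℤ
open import Data.List.Base using (List; []; _∷_; map; mapMaybe; foldr; allFin; length)
import Data.List.Base as List
open import Data.List.Relation.Unary.All using (All)
open import Data.List.Relation.Unary.Any using (Any)
open import Data.Maybe.Base as Maybe using (Maybe; just; nothing)
open import Data.Maybe using (Is-just)
open import Data.Nat.Base using (ℕ; zero; suc; _+_; _∸_; _≤_; _<_; NonZero; z≤n)
open import Data.Nat.Properties using (_≟_)
open import Data.Product.Base using (_×_; _,_; ∃-syntax)
open import Data.Rational.Base as ℚ using (ℚ; 0ℚ; 1ℚ)
import Data.Rational.Properties as ℚ
open import Data.Rational.Unnormalised.Base as ℚᵘ using (mkℚᵘ; *≤*)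
import Data.Rational.Unnormalised.Properties as ℚᵘ
open import Data.Vec.Base using (Vec; lookup; replicate; _[_]≔_)
open import Function.Bundles using (_⇔_)
open import Relation.Binary.PropositionalEquality using (_≡_; _≢_; subst₂; sym)
open import Relation.Nullary.Decidable using (yes; no)

private
  variable
    n : ℕ

------------------------------------------------------------------------
-- SAT formulas

-- (i , true) is xᵢ and (i , false) is its negation.
Literal : ℕ → Set
Literal n = Fin n × Bool

-- A disjunction of literals on pairwise distinct variables: each variable
-- occurs positively (just true), negatively (just false) or not at all.
-- Equality of clauses is thus equality of their literal sets.
Clause : ℕ → Set
Clause n = Vec (Maybe Bool) n

Formula : ℕ → Set
Formula n = List (Clause n)

literals : Clause n → List (Literal n)
literals {n} c = mapMaybe (λ i → Maybe.map (i ,_) (lookup c i)) (allFin n)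

IsWide : Clause n → Set
IsWide {n} c = (i : Fin n) → Is-just (lookup c i)

LiteralHolds : Vec Bool n → Literal n → Set
LiteralHolds x (i , b) = lookup x i ≡ b

Satisfies : Vec Bool n → Formula n → Set
Satisfies x φ = All (λ c → Any (LiteralHolds x) (literals c)) φ

Equivalent : Formula n → Formula n → Set
Equivalent {n} φ ψ = (x : Vec Bool n) → Satisfies x φ ⇔ Satisfies x ψ

------------------------------------------------------------------------
-- Probabilistic assignments and the worst-violated-constraint oracle

-- Rational probabilities only: these are the ones a machine can write down.
record Prob : Set where
  constructor prob
  field
    value   : ℚ
    value≥0 : 0ℚ ℚ.≤ value
    value≤1 : value ℚ.≤ 1ℚ

open Prob public

-- The probability p / q.
fraction : (p q : ℕ) .{{_ : NonZero q}} → p ≤ q → Prob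
fraction p q@(suc k) p≤q = prob (+ p ℚ./ q) ≥0 ≤1
  where
  ≃p/q : ℚ.toℚᵘ (+ p ℚ./ q) ℚᵘ.≃ mkℚᵘ (+ p) k
  ≃p/q = ℚ.toℚᵘ-fromℚᵘ (mkℚᵘ (+ p) k)

  ≥0 : 0ℚ ℚ.≤ + p ℚ./ q
  ≥0 = ℚ.nonNegative⁻¹ _ {{ℚ.normalize-nonNeg p q}}

  ≤1ᵘ : mkℚᵘ (+ p) k ℚᵘ.≤ ℚᵘ.1ℚᵘ
  ≤1ᵘ = *≤* (subst₂ ℤ._≤_ (sym (ℤ.*-identityʳ (+ p))) (sym (ℤ.*-identityˡ (+ q))) (ℤ.+≤+ p≤q))

  ≤1 : + p ℚ./ q ℚ.≤ 1ℚ
  ≤1 = ℚ.toℚᵘ-cancel-≤ (ℚᵘ.≤-respˡ-≃ (ℚᵘ.≃-sym ≃p/q) ≤1ᵘ)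

-- a(i) = Pr[xᵢ = 1]
ProbAssignment : ℕ → Set
ProbAssignment n = Vec Prob n

Pr[_≡0] : Literal n → ProbAssignment n → ℚ
Pr[ i , true  ≡0] a = 1ℚ ℚ.- value (lookup a i)
Pr[ i , false ≡0] a = value (lookup a i)

violation : ProbAssignment n → Clause n → ℚ
violation a c = foldr ℚ._*_ 1ℚ (map (λ ℓ → Pr[ ℓ ≡0] a) (literals c))

data ValidAnswer (φ : Formula n) (a : ProbAssignment n) : Maybe (Fin (length φ)) → Set where
  satisfied : (∀ j → violation a (List.lookup φ j) ≡ 0ℚ) → ValidAnswer φ a nothing
  worst     : ∀ j →
              violation a (List.lookup φ j) ≢ 0ℚ →
              (∀ k → violation a (List.lookup φ k) ℚ.≤ violation a (List.lookup φ j)) →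
              ValidAnswer φ a (just j)

-- The first argument of `answer` is the number of earlier queries, so ties
-- may be broken differently each time.  For a fixed deterministic algorithm
-- this is as strong as an adversary that sees the whole history.
record Oracle (φ : Formula n) : Set where
  field
    answer : ℕ → ProbAssignment n → Maybe (Fin (length φ))
    valid  : ∀ k a → ValidAnswer φ a (answer k a)

------------------------------------------------------------------------
-- Algorithms: programs for a unit-cost random access machine

data Expr : Set where
  lit     : ℕ → Expr
  reg     : ℕ → Expr
  mem     : Expr → Expr
  _⊕_ _⊖_ : Expr → Expr → Expr

infixl 6 _⊕_ _⊖_
infix  5 _≔_
infixr 4 _⨾_

data Program : Set where
  skip          : Program
  _≔_           : ℕ → Expr → Program
  store         : (address content : Expr) → Program
  _⨾_           : Program → Program → Program
  if_then_else_ : Expr → Program → Program → Program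
  while_loop_   : Expr → Program → Program
  setProb       : (i p q : Expr) → Program
  query         : ℕ → Program
  newClause     : Program
  addLiteral    : (i sign : Expr) → Program

-- `probs` is the assignment that the next query submits.  It persists
-- between queries and is changed one entry at a time by `setProb`.
record State (n : ℕ) : Set where
  constructor state
  field
    registers : ℕ → ℕ
    memory    : ℕ → ℕ
    probs     : ProbAssignment n
    queries   : ℕ
    output    : Formula n

open State public

-- The number of variables is the only input apart from the oracle.
initial : (n : ℕ) → State n
initial n = state (λ { 0 → n ; (suc _) → 0 }) (λ _ → 0)
                  (replicate n (fraction 0 1 z≤n)) 0 []

update : (ℕ → ℕ) → ℕ → ℕ → (ℕ → ℕ)
update f k v l with l ≟ k
... | yes _ = v
... | no  _ = f l

eval : State n → Expr → ℕ
eval s (lit k) = k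
eval s (reg r) = registers s r
eval s (mem e) = memory s (eval s e)
eval s (e ⊕ f) = eval s e + eval s f
eval s (e ⊖ f) = eval s e ∸ eval s f

-- The time to evaluate an expression: one unit per node.
cost : Expr → ℕ
cost (lit _) = 1
cost (reg _) = 1
cost (mem e) = 1 + cost e
cost (e ⊕ f) = 1 + cost e + cost f
cost (e ⊖ f) = 1 + cost e + cost f

encodeAnswer : ∀ {m} → Maybe (Fin m) → ℕ
encodeAnswer nothing  = 0
encodeAnswer (just j) = suc (toℕ j)

isNonZero : ℕ → Bool
isNonZero zero    = false
isNonZero (suc _) = true

module _ {φ : Formula n} (O : Oracle φ) where
  open Oracle O

  infix 3 ⟨_,_⟩⇓[_]_

  -- ⟨ P , s ⟩⇓[ t ] s′ : from s, with oracle O, the program P halts in state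
  -- s′ after exactly t units of time.  Invalid operations (an index out of
  -- range, a number that is not a probability, a second literal on the same
  -- variable in one clause) have no rule, so the machine gets stuck on them.
  data ⟨_,_⟩⇓[_]_ : Program → State n → ℕ → State n → Set where

    ⇓skip : ∀ {s} → ⟨ skip , s ⟩⇓[ 1 ] s

    ⇓≔ : ∀ {s r e} →
      ⟨ r ≔ e , s ⟩⇓[ 1 + cost e ]
        record s { registers = update (registers s) r (eval s e) }

    ⇓store : ∀ {s e f} →
      ⟨ store e f , s ⟩⇓[ 1 + cost e + cost f ]
        record s { memory = update (memory s) (eval s e) (eval s f) }

    ⇓⨾ : ∀ {P Q s s′ s″ t u} →
      ⟨ P , s ⟩⇓[ t ] s′ → ⟨ Q , s′ ⟩⇓[ u ] s″ →
      ⟨ P ⨾ Q , s ⟩⇓[ t + u ] s″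

    ⇓then : ∀ {e P Q s s′ t} →
      eval s e ≢ 0 → ⟨ P , s ⟩⇓[ t ] s′ →
      ⟨ if e then P else Q , s ⟩⇓[ 1 + cost e + t ] s′

    ⇓else : ∀ {e P Q s s′ t} →
      eval s e ≡ 0 → ⟨ Q , s ⟩⇓[ t ] s′ →
      ⟨ if e then P else Q , s ⟩⇓[ 1 + cost e + t ] s′

    ⇓stop : ∀ {e P s} →
      eval s e ≡ 0 →
      ⟨ while e loop P , s ⟩⇓[ 1 + cost e ] s

    ⇓loop : ∀ {e P s s′ s″ t u} →
      eval s e ≢ 0 → ⟨ P , s ⟩⇓[ t ] s′ → ⟨ while e loop P , s′ ⟩⇓[ u ] s″ →
      ⟨ while e loop P , s ⟩⇓[ 1 + cost e + t + u ] s″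

    ⇓setProb : ∀ {i p q s} →
      (i<n : eval s i < n) {{_ : NonZero (eval s q)}} (p≤q : eval s p ≤ eval s q) →
      ⟨ setProb i p q , s ⟩⇓[ 1 + cost i + cost p + cost q ]
        record s { probs = probs s [ fromℕ< i<n ]≔ fraction (eval s p) (eval s q) p≤q }

    ⇓query : ∀ {r s} →
      ⟨ query r , s ⟩⇓[ 1 ]
        record s { registers = update (registers s) r
                                 (encodeAnswer (answer (queries s) (probs s)))
                 ; queries   = suc (queries s) }

    ⇓newClause : ∀ {s} →
      ⟨ newClause , s ⟩⇓[ 1 ] record s { output = replicate n nothing ∷ output s }

    ⇓addLiteral : ∀ {i b c ψ s} →
      output s ≡ c ∷ ψ →
      (i<n : eval s i < n) → lookup c (fromℕ< i<n) ≡ nothing →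
      ⟨ addLiteral i b , s ⟩⇓[ 1 + cost i + cost b ]
        record s { output = (c [ fromℕ< i<n ]≔ just (isNonZero (eval s b))) ∷ ψ }

-- The program P, run with oracle O, halts within time T and outputs a
-- formula equivalent to the hidden one.
LearnsWithin : Program → {φ : Formula n} → Oracle φ → ℕ → Set
LearnsWithin {n} P {φ} O T =
  ∃[ t ] ∃[ s ] (⟨_,_⟩⇓[_]_ O P (initial n) t s × t ≤ T × Equivalent (output s) φ)

{-# OPTIONS --safe #-}

-- A wide clause is violated by exactly one point of the cube, so the formula
-- is the set of its forbidden points.  With some variables fixed by
-- probabilities 0 and 1 and all the others at 1/2, the oracle reports
-- satisfaction exactly when no forbidden point lies in the subcube.  A
-- depth-first search that fixes one variable at a time and abandons the empty
-- subcubes visits O(n m + 1) subcubes.  Together with the initialisation and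
-- the output this takes O(n (m + 1)) time, and n m ≤ C(n, m - 1) 2ᵐ as soon
-- as 2 ≤ m ≤ n.
module Submission where

open import Defs
open import Algebra.Apartness.Properties.HeytingCommutativeRing using (x#0y#0→xy#0)
open import Data.Bool.Base using (Bool; true; false)
import Data.Bool.Properties as Bool
open import Data.Fin.Base using (Fin; toℕ; fromℕ<)
open import Data.Fin.Properties using (toℕ<n; toℕ-fromℕ<; toℕ-injective)
open import Data.List.Base using (List; []; _∷_; map; filter; foldr; length; allFin)
import Data.List.Base as List
open import Data.List.Membership.Propositional using (_∈_)
open import Data.List.Membership.Propositional.Properties using (∈-allFin; ∈-filter⁺; ∈-lookup; ∈-length)
open import Data.List.Relation.Binary.Subset.Propositional using (_⊆_)
open import Data.List.Relation.Unary.All using (All; []; _∷_)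
import Data.List.Relation.Unary.All as All
import Data.List.Relation.Unary.All.Properties as All
import Data.List.Relation.Unary.Any as Any
open import Data.List.Relation.Unary.Any using (here; there; index)
import Data.List.Relation.Unary.Any.Properties as Any
open import Data.List.Relation.Unary.Unique.Propositional using (Unique)
open import Data.Maybe.Base as Maybe using (Maybe; just; nothing)
open import Data.Maybe.Properties using (≡-dec; just-injective)
import Data.Maybe.Relation.Unary.All as MAll
import Data.Maybe.Relation.Unary.Any as MAny
open import Data.Nat.Base using (ℕ; zero; suc; _+_; _*_; _∸_; _^_; _≤_; _<_; z≤n; s≤s; s≤s⁻¹; >-nonZero)
open import Data.Nat.Combinatorics using (_C_; nC1≡n; nCk+nC[k+1]≡[n+1]C[k+1])
open import Data.Nat.Properties
open import Data.Nat.Solver using (module +-*-Solver)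
open import Data.Product.Base using (_×_; _,_; ∃-syntax)
open import Data.Rational.Base as ℚ using (ℚ; 0ℚ; 1ℚ; ½)
import Data.Rational.Properties as ℚ
open import Data.Sum.Base using (inj₁; inj₂)
open import Data.Vec.Base using (Vec; lookup; tabulate; _[_]≔_)
import Data.Vec.Properties as Vec
open import Function.Base using (_∘_; case_of_)
open import Function.Bundles using (mk⇔)
open import Relation.Binary.PropositionalEquality
open import Relation.Nullary.Decidable using (yes; no)
open import Relation.Nullary.Negation using (contradiction; ¬_)
open import Relation.Unary using (Decidable)
open import Relation.Unary.Properties using (∁?)

private
  variable
    n : ℕ
    A : Set

-- Updates of functions and vectors, and splitting a list

update-at : ∀ {f k v l} → l ≡ k → update f k v l ≡ v
update-at {k = k} {l = l} l≡k with l ≟ k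
... | yes _   = refl
... | no  l≢k = contradiction l≡k l≢k

update-off : ∀ {f k v l} → l ≢ k → update f k v l ≡ f l
update-off {k = k} {l = l} l≢k with l ≟ k
... | yes l≡k = contradiction l≡k l≢k
... | no  _   = refl

set-at : ∀ {a} (xs : Vec A n) (a<n : a < n) {y} (i : Fin n) → toℕ i ≡ a →
         lookup (xs [ fromℕ< a<n ]≔ y) i ≡ y
set-at xs a<n i i≡a with refl ← toℕ-injective (trans i≡a (sym (toℕ-fromℕ< a<n))) =
  Vec.lookup∘update i xs _

set-off : ∀ {a} (xs : Vec A n) (a<n : a < n) {y} (i : Fin n) → toℕ i ≢ a →
          lookup (xs [ fromℕ< a<n ]≔ y) i ≡ lookup xs i
set-off xs a<n i i≢a =
  Vec.lookup∘update′ (λ i≡ → i≢a (trans (cong toℕ i≡) (toℕ-fromℕ< a<n))) xs _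

lookup-injective : (xs ys : Vec A n) → (∀ i → lookup xs i ≡ lookup ys i) → xs ≡ ys
lookup-injective xs ys eq = begin
  xs                    ≡⟨ Vec.tabulate∘lookup xs ⟨
  tabulate (lookup xs) ≡⟨ Vec.tabulate-cong eq ⟩
  tabulate (lookup ys) ≡⟨ Vec.tabulate∘lookup ys ⟩
  ys                    ∎
  where open ≡-Reasoning

length-filter-∁ : {P : A → Set} (P? : Decidable P) (xs : List A) →
                  length (filter P? xs) + length (filter (∁? P?) xs) ≡ length xs
length-filter-∁ P? []       = refl
length-filter-∁ P? (x ∷ xs) with P? x
... | yes _ = cong suc (length-filter-∁ P? xs)
... | no  _ = trans (+-suc _ _) (cong suc (length-filter-∁ P? xs))

-- Violation probabilities

∈-literals : (c : Clause n) (i : Fin n) {b : Bool} → lookup c i ≡ just b → (i , b) ∈ literals c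
∈-literals {n} c i {b} ci≡b =
  Any.mapMaybe⁺ _ (allFin n) (Any.map⁺ (Any.map (λ { refl → occurs }) (∈-allFin i)))
  where
  occurs : MAny.Any ((i , b) ≡_) (Maybe.map (i ,_) (lookup c i))
  occurs rewrite ci≡b = MAny.just refl

literals-All : (c : Clause n) {P : Literal n → Set} →
               (∀ i b → lookup c i ≡ just b → P (i , b)) → All P (literals c)
literals-All {n} c {P} h = All.mapMaybe⁺ (All.map⁺ (All.universal each (allFin n)))
  where
  each : ∀ i → MAll.All P (Maybe.map (i ,_) (lookup c i))
  each i with lookup c i in eq
  ... | nothing = MAll.nothing
  ... | just b  = MAll.just (h i b eq)

-- ℚ is a field, and the apartness of its Heyting ring structure is plain inequality.
product≢0⁺ : {f : A → ℚ} {xs : List A} → All (λ x → f x ≢ 0ℚ) xs →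
             foldr ℚ._*_ 1ℚ (map f xs) ≢ 0ℚ
product≢0⁺ []         = ℚ.1≢0
product≢0⁺ (px ∷ pxs) = x#0y#0→xy#0 ℚ.heytingCommutativeRing px (product≢0⁺ pxs)

product≢0⁻ : {f : A → ℚ} (xs : List A) → foldr ℚ._*_ 1ℚ (map f xs) ≢ 0ℚ →
             All (λ x → f x ≢ 0ℚ) xs
product≢0⁻ []       _ = []
product≢0⁻ {f = f} (x ∷ xs) h =
  (λ fx≡0 → h (trans (cong (λ p → p ℚ.* foldr ℚ._*_ 1ℚ (map f xs)) fx≡0) (ℚ.*-zeroˡ (foldr ℚ._*_ 1ℚ (map f xs))))) ∷
  product≢0⁻ xs (λ r≡0 → h (trans (cong (f x ℚ.*_) r≡0) (ℚ.*-zeroʳ (f x))))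

-- Bits are memory contents: 0 stands for the bit 0 and every other number for the bit 1.
point : ℕ → ℚ
point zero    = 0ℚ
point (suc _) = 1ℚ

-- The sign of the literal that is false where the variable has the given bit.
sign : ℕ → Bool
sign v = isNonZero (1 ∸ v)

-- A fixed variable makes one of its literals certainly true and the other certainly false; only the
-- false one keeps the product from vanishing.
Pr≢0⇒sign : (a : ProbAssignment n) (i : Fin n) (b : Bool) (v : ℕ) →
            value (lookup a i) ≡ point v → Pr[ i , b ≡0] a ≢ 0ℚ → b ≡ sign v
Pr≢0⇒sign a i true  zero    eq h = refl
Pr≢0⇒sign a i false zero    eq h = contradiction eq h
Pr≢0⇒sign a i true  (suc v) eq h = contradiction (cong (λ p → 1ℚ ℚ.- p) eq) h
Pr≢0⇒sign a i false (suc v) eq h = sym (cong isNonZero (0∸n≡0 v))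

sign⇒Pr≢0 : (a : ProbAssignment n) (i : Fin n) (b : Bool) (v : ℕ) →
            value (lookup a i) ≡ point v → b ≡ sign v → Pr[ i , b ≡0] a ≢ 0ℚ
sign⇒Pr≢0 a i .true zero    eq refl h rewrite eq = ℚ.1≢0 h
sign⇒Pr≢0 a i b     (suc v) eq b≡   h rewrite 0∸n≡0 v | b≡ = ℚ.1≢0 (trans (sym eq) h)

-- At 1/2 both literals fail with positive probability, so a free variable cannot make the product
-- vanish.
½⇒Pr≢0 : (a : ProbAssignment n) (i : Fin n) (b : Bool) →
         value (lookup a i) ≡ ½ → Pr[ i , b ≡0] a ≢ 0ℚ
½⇒Pr≢0 a i true  eq h with () ← trans (sym (cong (λ p → 1ℚ ℚ.- p) eq)) h
½⇒Pr≢0 a i false eq h with () ← trans (sym eq) h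

-- Forbidden points and subcubes

-- The point violating c agrees with x from the variable k on.
record Matches (k : ℕ) (x : ℕ → ℕ) (c : Clause n) : Set where
  constructor matches
  field
    at : ∀ i → k ≤ toℕ i → lookup c i ≡ just (sign (x (toℕ i)))

open Matches

-- The memory and the assignment describe a subcube: the variables below lo are
-- free, and those from hi on are fixed to the bits x.
record Subcube (lo hi : ℕ) (x : ℕ → ℕ) (a : ProbAssignment n) (M : ℕ → ℕ) : Set where
  field
    free   : ∀ i → toℕ i < lo → value (lookup a i) ≡ ½
    fixed  : ∀ i → hi ≤ toℕ i → value (lookup a i) ≡ point (x (toℕ i))
    stored : ∀ (i : Fin n) → hi ≤ toℕ i → M (toℕ i) ≡ x (toℕ i)

open Subcube

module _ {k : ℕ} {x : ℕ → ℕ} {a : ProbAssignment n} {M : ℕ → ℕ} (S : Subcube k k x a M) where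

  violated⇒Matches : (c : Clause n) → IsWide c → violation a c ≢ 0ℚ → Matches k x c
  violated⇒Matches c wide h .at i k≤i with lookup c i in eq | wide i
  ... | just b | _ = cong just (Pr≢0⇒sign a i b (x (toℕ i)) (fixed S i k≤i)
                       (All.lookup (product≢0⁻ (literals c) h) (∈-literals c i eq)))

  Matches⇒violated : (c : Clause n) → Matches k x c → violation a c ≢ 0ℚ
  Matches⇒violated c match = product≢0⁺ (literals-All c each)
    where
    each : ∀ i b → lookup c i ≡ just b → Pr[ i , b ≡0] a ≢ 0ℚ
    each i b eq with ≤-<-connex k (toℕ i)
    ... | inj₁ k≤i = sign⇒Pr≢0 a i b (x (toℕ i)) (fixed S i k≤i)
                       (just-injective (trans (sym eq) (at match i k≤i)))
    ... | inj₂ i<k = ½⇒Pr≢0 a i b (free S i i<k)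

module _ {x : ℕ → ℕ} {a : ProbAssignment n} {M : ℕ → ℕ} where

  recall : ∀ {k l} → Subcube k k x a M → k < n → l ≡ k → M l ≡ x k
  recall {k} S k<n refl = begin
    M k                  ≡⟨ cong M (toℕ-fromℕ< k<n) ⟨
    M (toℕ (fromℕ< k<n)) ≡⟨ stored S (fromℕ< k<n) (≤-reflexive (sym (toℕ-fromℕ< k<n))) ⟩
    x (toℕ (fromℕ< k<n)) ≡⟨ cong x (toℕ-fromℕ< k<n) ⟩
    x k                  ∎
    where open ≡-Reasoning

  -- Opens a gap between `lo` and `hi` about which nothing is claimed. A variable passes through it
  -- while it is being fixed, freed or switched to the other bit.
  Subcube-weaken : ∀ {lo lo′ hi hi′} → lo′ ≤ lo → hi ≤ hi′ → Subcube lo hi x a M → Subcube lo′ hi′ x a M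
  Subcube-weaken lo≤ hi≤ S = record
    { free   = λ i i< → free S i (<-≤-trans i< lo≤)
    ; fixed  = λ i ≤i → fixed S i (≤-trans hi≤ ≤i)
    ; stored = λ i ≤i → stored S i (≤-trans hi≤ ≤i) }

  -- Bits below `hi` may be stale: after both halves of a subcube are searched, `x` has changed at
  -- most at a variable that is free again.
  Subcube-cong : ∀ {lo hi y} → (∀ i → hi ≤ i → x i ≡ y i) → Subcube lo hi x a M → Subcube lo hi y a M
  Subcube-cong x≡y S = record
    { free   = free S
    ; fixed  = λ i ≤i → trans (fixed S i ≤i) (cong point (x≡y _ ≤i))
    ; stored = λ i ≤i → trans (stored S i ≤i) (x≡y _ ≤i) }

  -- `l` and `r` are values of expressions that the program evaluates, hence only propositionally
  -- equal to `k`.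
  Subcube-fix : ∀ {k v p l r} → Subcube k (suc k) x a M →
                (l<n : l < n) → l ≡ k → r ≡ k → value p ≡ point v →
                Subcube k k (update x k v) (a [ fromℕ< l<n ]≔ p) (update M r v)
  Subcube-fix {k} {v} {p} S l<n refl refl p≡v = record
    { free   = λ i i<k → trans (cong value (set-off a l<n i (<⇒≢ i<k))) (free S i i<k)
    ; fixed  = fixed′
    ; stored = stored′ }
    where
    fixed′ : ∀ i → k ≤ toℕ i →
             value (lookup (a [ fromℕ< l<n ]≔ p) i) ≡ point (update x k v (toℕ i))
    fixed′ i k≤i with toℕ i ≟ k
    ... | yes i≡k = trans (cong value (set-at a l<n i i≡k)) p≡v
    ... | no  i≢k = trans (cong value (set-off a l<n i i≢k)) (fixed S i (≤∧≢⇒< k≤i (≢-sym i≢k)))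

    stored′ : ∀ (i : Fin n) → k ≤ toℕ i → update M k v (toℕ i) ≡ update x k v (toℕ i)
    stored′ i k≤i with toℕ i ≟ k
    ... | yes i≡k = refl
    ... | no  i≢k = stored S i (≤∧≢⇒< k≤i (≢-sym i≢k))

  Subcube-free : ∀ {k hi p l} → Subcube k hi x a M → k < hi →
                 (l<n : l < n) → l ≡ k → value p ≡ ½ →
                 Subcube (suc k) hi x (a [ fromℕ< l<n ]≔ p) M
  Subcube-free {k} {hi} {p} S k<hi l<n refl p≡½ = record
    { free   = free′
    ; fixed  = λ i ≤i → trans (cong value (set-off a l<n i (>⇒≢ (<-≤-trans k<hi ≤i)))) (fixed S i ≤i)
    ; stored = stored S }
    where
    free′ : ∀ i → toℕ i < suc k → value (lookup (a [ fromℕ< l<n ]≔ p) i) ≡ ½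
    free′ i i<1+k with toℕ i ≟ k
    ... | yes i≡k = trans (cong value (set-at a l<n i i≡k)) p≡½
    ... | no  i≢k = trans (cong value (set-off a l<n i i≢k)) (free S i (≤∧≢⇒< (s≤s⁻¹ i<1+k) i≢k))

-- The learning program

-- Register 0 holds n, register 1 the number k of free variables, register 2
-- the mode (1: enter a subcube, 2: leave it, 0: halt), register 3 the answer
-- of the oracle and register 4 the number of literals still to be written.
-- The variables are fixed from the last one down, so the free ones are those
-- below k.

initialise : Program
initialise =
  while reg 0 ⊖ reg 1 loop
    (setProb (reg 1) (lit 1) (lit 2) ⨾ 1 ≔ reg 1 ⊕ lit 1)

-- The oracle reveals only an index, so the clause is rebuilt from the point in memory: each sign
-- negates a bit, which makes every literal false there.
writeLiterals : Program
writeLiterals =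
  while reg 4 loop
    (4 ≔ reg 4 ⊖ lit 1 ⨾ addLiteral (reg 4) (lit 1 ⊖ mem (reg 4)))

emit : Program
emit = newClause ⨾ 4 ≔ reg 0 ⨾ writeLiterals

descend : Program
descend = 1 ≔ reg 1 ⊖ lit 1 ⨾ store (reg 1) (lit 0) ⨾ setProb (reg 1) (lit 0) (lit 1)

enter : Program
enter = query 3 ⨾
  if reg 3 then (if reg 1 then descend else (emit ⨾ 2 ≔ lit 2)) else (2 ≔ lit 2)

-- The stored bits serve as the stack of the search: for the variable fixed last, 1 means that both
-- halves are done and 0 that the second is still to come.
retreat : Program
retreat =
  if mem (reg 1)
  then (setProb (reg 1) (lit 1) (lit 2) ⨾ 1 ≔ reg 1 ⊕ lit 1)
  else (store (reg 1) (lit 1) ⨾ setProb (reg 1) (lit 1) (lit 1) ⨾ 2 ≔ lit 1)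

leave : Program
leave = if reg 0 ⊖ reg 1 then retreat else (2 ≔ lit 0)

search : Program
search = while reg 2 loop (if reg 2 ⊖ lit 1 then leave else enter)

learner : Program
learner = initialise ⨾ 2 ≔ lit 1 ⨾ search

-- Invariant of the search and composition of its runs

module Search {n : ℕ} {φ : Formula n} (wide : All IsWide φ) (O : Oracle φ) where
  open Oracle O

  record Node (mode k : ℕ) (x : ℕ → ℕ) (s : State n) : Set where
    -- With eta, the terms for the runs below would unfold at every use.
    no-eta-equality
    pattern
    constructor node
    field
      reg0≡n    : registers s 0 ≡ n
      reg1≡k    : registers s 1 ≡ k
      reg2≡mode : registers s 2 ≡ mode
      subcube   : Subcube k k x (probs s) (memory s)

  open Node

  -- The search, resumed from s, passes through s′ after at most T units of time.
  record _⟶[_]_ (s : State n) (T : ℕ) (s′ : State n) : Set where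
    field
      elapsed   : ℕ
      elapsed≤T : elapsed ≤ T
      resume    : ∀ {u s″} → ⟨_,_⟩⇓[_]_ O search s′ u s″ → ⟨_,_⟩⇓[_]_ O search s (elapsed + u) s″

  open _⟶[_]_

  ⟶-trans : ∀ {s s′ s″ T U} → s ⟶[ T ] s′ → s′ ⟶[ U ] s″ → s ⟶[ T + U ] s″
  ⟶-trans {s} p q = record
    { elapsed   = elapsed p + elapsed q
    ; elapsed≤T = +-mono-≤ (elapsed≤T p) (elapsed≤T q)
    ; resume    = λ {_} {s″} d → subst (λ t → ⟨_,_⟩⇓[_]_ O search s t s″) (sym (+-assoc (elapsed p) _ _))
                          (resume p (resume q d)) }

  ⟶-weaken : ∀ {s s′ T U} → T ≤ U → s ⟶[ T ] s′ → s ⟶[ U ] s′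
  ⟶-weaken T≤U p = record
    { elapsed = elapsed p ; elapsed≤T = ≤-trans (elapsed≤T p) T≤U ; resume = resume p }

  -- The 6 units are the loop test (2) and the test of the mode (4).
  enter-step : ∀ {s s′ t} → registers s 2 ≡ 1 → ⟨_,_⟩⇓[_]_ O enter s t s′ → s ⟶[ 6 + t ] s′
  enter-step {t = t} mode d = record
    { elapsed   = 6 + t
    ; elapsed≤T = ≤-refl
    ; resume    = ⇓loop (λ z → 1+n≢0 (trans (sym mode) z)) (⇓else (cong (_∸ 1) mode) d) }

  leave-step : ∀ {s s′ t} → registers s 2 ≡ 2 → ⟨_,_⟩⇓[_]_ O leave s t s′ → s ⟶[ 6 + t ] s′
  leave-step {t = t} mode d = record
    { elapsed   = 6 + t
    ; elapsed≤T = ≤-refl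
    ; resume    = ⇓loop (λ z → 1+n≢0 (trans (sym mode) z))
                        (⇓then (λ z → 1+n≢0 (trans (sym (cong (_∸ 1) mode)) z)) d) }

  private
    variable
      k : ℕ
      x : ℕ → ℕ
      s : State n

  -- Single moves of the search

  miss : Node 1 k x s → answer (queries s) (probs s) ≡ nothing →
         ∃[ s′ ] (s ⟶[ 11 ] s′ × Node 2 k x s′ × output s′ ≡ output s)
  miss (node r₀ r₁ r₂ S) ans =
    _ , enter-step r₂ (⇓⨾ ⇓query (⇓else (cong encodeAnswer ans) ⇓≔)) , node r₀ r₁ refl S , refl

  goDown : Node 1 (suc k) x s → suc k ≤ n → ∀ {j} → answer (queries s) (probs s) ≡ just j →
           ∃[ s′ ] (s ⟶[ 22 ] s′ × Node 1 k (update x k 0) s′ × output s′ ≡ output s)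
  goDown {k} {x} {s} (node r₀ r₁ r₂ S) k<n ans =
    _ , enter-step r₂ (⇓⨾ ⇓query (⇓then (λ z → 1+n≢0 (trans (sym (cong encodeAnswer ans)) z))
          (⇓then (λ z → 1+n≢0 (trans (sym r₁) z))
            (⇓⨾ ⇓≔ (⇓⨾ ⇓store (⇓setProb l<n z≤n)))))) ,
    node r₀ l≡k r₂ (Subcube-fix (Subcube-weaken (n≤1+n k) ≤-refl S) l<n l≡k l≡k refl) , refl
    where
    l≡k : registers s 1 ∸ 1 ≡ k
    l≡k = cong (_∸ 1) r₁

    l<n : registers s 1 ∸ 1 < n
    l<n = subst (_< n) (sym l≡k) k<n

  reg0∸reg1≢0 : registers s 0 ≡ n → registers s 1 ≡ k → k < n → registers s 0 ∸ registers s 1 ≢ 0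
  reg0∸reg1≢0 r₀ r₁ k<n rewrite r₀ | r₁ = m>n⇒m∸n≢0 k<n

  goAcross : Node 2 k x s → k < n → x k ≡ 0 →
             ∃[ s′ ] (s ⟶[ 22 ] s′ × Node 1 k (update x k 1) s′ × output s′ ≡ output s)
  goAcross {k} {x} {s} (node r₀ r₁ r₂ S) k<n xk≡0 =
    _ , leave-step r₂ (⇓then (reg0∸reg1≢0 {s = s} r₀ r₁ k<n) (⇓else (trans (recall S k<n r₁) xk≡0)
          (⇓⨾ ⇓store (⇓⨾ (⇓setProb l<n ≤-refl) ⇓≔)))) ,
    node r₀ r₁ refl (Subcube-fix (Subcube-weaken ≤-refl (n≤1+n k) S) l<n r₁ r₁ refl) , refl
    where
    l<n : registers s 1 < n
    l<n = subst (_< n) (sym r₁) k<n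

  goUp : Node 2 k x s → k < n → x k ≡ 1 →
         ∃[ s′ ] (s ⟶[ 21 ] s′ × Node 2 (suc k) x s′ × output s′ ≡ output s)
  goUp {k} {x} {s} (node r₀ r₁ r₂ S) k<n xk≡1 =
    _ , leave-step r₂ (⇓then (reg0∸reg1≢0 {s = s} r₀ r₁ k<n) (⇓then (λ z → 1+n≢0 (trans (sym xk≡1) (trans (sym (recall S k<n r₁)) z)))
          (⇓⨾ (⇓setProb l<n (s≤s z≤n)) ⇓≔))) ,
    node r₀ (trans (cong (_+ 1) r₁) (+-comm k 1)) r₂
      (Subcube-free (Subcube-weaken ≤-refl (n≤1+n k) S) ≤-refl l<n r₁ refl) , refl
    where
    l<n : registers s 1 < n
    l<n = subst (_< n) (sym r₁) k<n

  -- Writing out a clause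

  record Written (P : Program) (s : State n) (ψ : Formula n) (t : ℕ) : Set where
    constructor written
    field
      {s′}     : State n
      {clause} : Clause n
      run      : ⟨_,_⟩⇓[_]_ O P s t s′
      output≡  : output s′ ≡ clause ∷ ψ
      lookup≡  : ∀ i → lookup clause i ≡ just (sign (memory s (toℕ i)))
      reg0≡    : registers s′ 0 ≡ registers s 0
      reg1≡    : registers s′ 1 ≡ registers s 1
      memory≡  : memory s′ ≡ memory s
      probs≡   : probs s′ ≡ probs s

  open Written

  -- The counter runs down from `n`: the literals from `j` on are written, and the blanks below `j`
  -- keep `addLiteral` from getting stuck. An iteration takes 2 + 4 + 6 units, the last test 2.
  runWriteLiterals : ∀ j (s : State n) {c ψ} → registers s 4 ≡ j → j ≤ n → output s ≡ c ∷ ψ →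
    (∀ i → toℕ i < j → lookup c i ≡ nothing) →
    (∀ i → j ≤ toℕ i → lookup c i ≡ just (sign (memory s (toℕ i)))) →
    Written writeLiterals s ψ (j * 12 + 2)
  runWriteLiterals zero s r₄ _ out _ done =
    written (⇓stop r₄) out (λ i → done i z≤n) refl refl refl refl
  runWriteLiterals (suc j) s {c} r₄ j<n out blank done =
    written (⇓loop (λ z → 1+n≢0 (trans (sym r₄) z)) (⇓⨾ ⇓≔ add) (run rest))
      (output≡ rest) (lookup≡ rest) (reg0≡ rest) (reg1≡ rest) (memory≡ rest) (probs≡ rest)
    where
    l : ℕ
    l = registers s 4 ∸ 1

    l≡j : l ≡ j
    l≡j = cong (_∸ 1) r₄

    l<n : l < n
    l<n = subst (_< n) (sym l≡j) j<n

    c′ : Clause n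
    c′ = c [ fromℕ< l<n ]≔ just (sign (memory s l))

    add = ⇓addLiteral {O = O} {i = reg 4} {b = lit 1 ⊖ mem (reg 4)}
            {s = record s { registers = update (registers s) 4 l }} out l<n
            (blank (fromℕ< l<n) (s≤s (≤-reflexive (trans (toℕ-fromℕ< l<n) l≡j))))

    blank′ : ∀ i → toℕ i < j → lookup c′ i ≡ nothing
    blank′ i i<j = trans (set-off c l<n i (λ i≡l → <⇒≢ i<j (trans i≡l l≡j))) (blank i (m<n⇒m<1+n i<j))

    done′ : ∀ i → j ≤ toℕ i → lookup c′ i ≡ just (sign (memory s (toℕ i)))
    done′ i j≤i with toℕ i ≟ l
    ... | yes i≡l = trans (set-at c l<n i i≡l) (cong (just ∘ sign ∘ memory s) (sym i≡l))
    ... | no  i≢l = trans (set-off c l<n i i≢l)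
                      (done i (≤∧≢⇒< j≤i (λ j≡i → i≢l (trans (sym j≡i) (sym l≡j)))))

    rest = runWriteLiterals j _ l≡j (<⇒≤ j<n) refl blank′ done′

  runEmit : ∀ s → registers s 0 ≡ n → Written emit s (output s) (3 + (n * 12 + 2))
  runEmit s r₀ = written (⇓⨾ ⇓newClause (⇓⨾ ⇓≔ (run rest)))
    (output≡ rest) (lookup≡ rest) (reg0≡ rest) (reg1≡ rest) (memory≡ rest) (probs≡ rest)
    where
    rest = runWriteLiterals n _ r₀ ≤-refl refl
             (λ i _ → Vec.lookup-replicate i nothing)
             (λ i n≤i → contradiction (toℕ<n i) (≤⇒≯ n≤i))

  hit : Node 1 0 x s → ∀ {j} → answer (queries s) (probs s) ≡ just j →
        ∃[ s′ ] ∃[ c ] (s ⟶[ 22 + 12 * n ] s′ × Node 2 0 x s′ ×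
                        output s′ ≡ c ∷ output s × Matches 0 x c)
  hit {x} {s} (node r₀ r₁ r₂ S) ans =
    _ , clause w ,
    ⟶-weaken time≤ (enter-step r₂ (⇓⨾ ⇓query (⇓then (λ z → 1+n≢0 (trans (sym (cong encodeAnswer ans)) z))
      (⇓else r₁ (⇓⨾ (run w) ⇓≔))))) ,
    node (trans (reg0≡ w) r₀) (trans (reg1≡ w) r₁) refl
      (subst₂ (Subcube 0 0 x) (sym (probs≡ w)) (sym (memory≡ w)) S) ,
    output≡ w ,
    matches (λ i _ → trans (lookup≡ w i) (cong (just ∘ sign) (stored S i z≤n)))
    where
    w = runEmit _ r₀

    -- The exact time 18 + 12 n is rounded up to `visitTime 0 1`.
    time≤ : 6 + (1 + (2 + (2 + (3 + (n * 12 + 2) + 2)))) ≤ 22 + 12 * n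
    time≤ = begin
      14 + (n * 12 + 2 + 2) ≡⟨ solve 1 (λ n → con 14 :+ (n :* con 12 :+ con 2 :+ con 2) := con 18 :+ con 12 :* n) refl n ⟩
      18 + 12 * n           ≤⟨ +-monoˡ-≤ (12 * n) (m≤m+n 18 4) ⟩
      22 + 12 * n           ∎
      where
      open ≤-Reasoning
      open +-*-Solver

  -- Recursive visit of a subcube

  -- The time for a subcube with k free variables and ℓ forbidden points.
  visitTime : ℕ → ℕ → ℕ
  visitTime k ℓ = 22 + (88 * k + 12 * n) * ℓ

  -- `sound` is relative to the earlier output, so that successive visits compose.
  record Visited (k : ℕ) (x : ℕ → ℕ) (ℓ : ℕ) (s : State n) : Set where
    constructor visited
    field
      {s′}     : State n
      passes   : s ⟶[ visitTime k ℓ ] s′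
      leaving  : Node 2 k x s′
      sound    : output s ⊆ φ → output s′ ⊆ φ
      keeps    : output s ⊆ output s′
      complete : ∀ {c} → c ∈ φ → Matches k x c → c ∈ output s′

  -- With every variable fixed, the bits prescribe all the literals.
  Matches-0-unique : ∀ {c c′ : Clause n} → Matches 0 x c → Matches 0 x c′ → c ≡ c′
  Matches-0-unique {c = c} {c′} h h′ = lookup-injective c c′ (λ i → trans (at h i z≤n) (sym (at h′ i z≤n)))

  -- The literal on the variable `k` decides which half of the subcube holds the forbidden point of
  -- `c`.
  Matches-fix : ∀ {c : Clause n} {y v} → (∀ i → suc k ≤ i → x i ≡ y i) → y k ≡ v → (k<n : k < n) →
                lookup c (fromℕ< k<n) ≡ just (sign v) → Matches (suc k) x c → Matches k y c
  Matches-fix {k} {x} {c} {y} x≡y yk≡v k<n ck h .at i k≤i with toℕ i ≟ k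
  ... | no  i≢k = trans (at h i k<i) (cong (just ∘ sign) (x≡y (toℕ i) k<i))
    where
    k<i : suc k ≤ toℕ i
    k<i = ≤∧≢⇒< k≤i (≢-sym i≢k)
  ... | yes i≡k = subst (λ i → lookup c i ≡ just (sign (y (toℕ i))))
                     (toℕ-injective (trans (toℕ-fromℕ< k<n) (sym i≡k)))
                     (trans ck (cong (just ∘ sign) (sym (trans (cong y (toℕ-fromℕ< k<n)) yk≡v))))

  Matches-unfix : ∀ {c : Clause n} {y} → (∀ i → suc k ≤ i → x i ≡ y i) → Matches k y c → Matches (suc k) x c
  Matches-unfix x≡y h .at i k<i = trans (at h i (<⇒≤ k<i)) (cong (just ∘ sign) (sym (x≡y (toℕ i) k<i)))

  -- The moves at an inner node cost 22 + 22 + 21 and its two children have constant terms 22 + 22,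
  -- in total 109 = 22 + 87. As 1 ≤ ℓ, the 87 is covered by the 88 ℓ that one more free variable
  -- contributes.
  visitTime-split : ∀ k {ℓ₀ ℓ₁ ℓ} → ℓ₀ + ℓ₁ ≡ ℓ → 1 ≤ ℓ →
    22 + (visitTime k ℓ₀ + (22 + (visitTime k ℓ₁ + 21))) ≤ visitTime (suc k) ℓ
  visitTime-split k {ℓ₀} {ℓ₁} refl 1≤ℓ = begin
    22 + (visitTime k ℓ₀ + (22 + (visitTime k ℓ₁ + 21)))
      ≡⟨ solve 4 (λ k n a b →
           con 22 :+ ((con 22 :+ (con 88 :* k :+ con 12 :* n) :* a) :+ (con 22 :+
             ((con 22 :+ (con 88 :* k :+ con 12 :* n) :* b) :+ con 21)))
           := con 109 :+ (con 88 :* k :+ con 12 :* n) :* (a :+ b)) refl k n ℓ₀ ℓ₁ ⟩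
    109 + e * ℓ       ≤⟨ +-monoˡ-≤ (e * ℓ) (+-mono-≤ (≤-refl {22}) (≤-trans (m≤m+n 87 1) (*-monoʳ-≤ 88 1≤ℓ))) ⟩
    22 + 88 * ℓ + e * ℓ
      ≡⟨ solve 3 (λ k n c → con 22 :+ con 88 :* c :+ (con 88 :* k :+ con 12 :* n) :* c
           := con 22 :+ (con 88 :* (con 1 :+ k) :+ con 12 :* n) :* c) refl k n ℓ ⟩
    visitTime (suc k) ℓ ∎
    where
    open ≤-Reasoning
    open +-*-Solver
    e = 88 * k + 12 * n
    ℓ = ℓ₀ + ℓ₁

  -- A forbidden point in the subcube would give its clause a nonzero violation probability.
  ∉-satisfied : Node 1 k x s → ValidAnswer φ (probs s) nothing → ∀ {c} → c ∈ φ → ¬ Matches k x c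
  ∉-satisfied {s = s} N (satisfied all≡0) {c} c∈φ h =
    Matches⇒violated (subcube N) c h
      (trans (cong (violation (probs s)) (Any.lookup-index c∈φ)) (all≡0 (index c∈φ)))

  worst-Matches : ∀ {j} → Node 1 k x s → ValidAnswer φ (probs s) (just j) → Matches k x (List.lookup φ j)
  worst-Matches {j = j} N (worst .j viol≢0 _) =
    violated⇒Matches (subcube N) _ (All.lookup wide (∈-lookup j)) viol≢0

  Matches-at : ∀ {c : Clause n} {v} → x k ≡ v → (k<n : k < n) → Matches k x c →
               lookup c (fromℕ< k<n) ≡ just (sign v)
  Matches-at {x} xk≡v k<n h =
    trans (at h (fromℕ< k<n) (≤-reflexive (sym (toℕ-fromℕ< k<n))))
          (cong (just ∘ sign) (trans (cong x (toℕ-fromℕ< k<n)) xk≡v))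

  -- L stands for the forbidden points of the subcube: only a bound on their
  -- number is needed.
  Visitor : ℕ → Set
  Visitor k = ∀ x s → Node 1 k x s → (L : List (Clause n)) →
              (∀ {c} → c ∈ φ → Matches k x c → c ∈ L) → Visited k x (length L) s

  visitBranch : k < n → Visitor k → Node 1 (suc k) x s → ∀ {j} → answer (queries s) (probs s) ≡ just j →
                Matches (suc k) x (List.lookup φ j) → (L : List (Clause n)) →
                (∀ {c} → c ∈ φ → Matches (suc k) x c → c ∈ L) → Visited (suc k) x (length L) s
  visitBranch {k} {x} {s} k<n ih N {j} ans matchⱼ L cover = both
    where
    x₀ x₁ : ℕ → ℕ
    x₀ = update x k 0
    x₁ = update x₀ k 1

    x₀k≡0 : x₀ k ≡ 0
    x₀k≡0 = update-at {x} {k} refl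

    x₁k≡1 : x₁ k ≡ 1
    x₁k≡1 = update-at {x₀} {k} refl

    x≡x₀ : ∀ i → suc k ≤ i → x i ≡ x₀ i
    x≡x₀ i k<i = sym (update-off (>⇒≢ k<i))

    x≡x₁ : ∀ i → suc k ≤ i → x i ≡ x₁ i
    x≡x₁ i k<i = trans (x≡x₀ i k<i) (sym (update-off (>⇒≢ k<i)))

    -- A variable that occurs positively is 0 at the forbidden point, which then lies in the first
    -- half; `L` is split accordingly.
    positive? : Decidable (λ (c : Clause n) → lookup c (fromℕ< k<n) ≡ just true)
    positive? c = ≡-dec Bool._≟_ (lookup c (fromℕ< k<n)) (just true)

    cover₀ : ∀ {c} → c ∈ φ → Matches k x₀ c → c ∈ filter positive? L
    cover₀ c∈φ h = ∈-filter⁺ positive? (cover c∈φ (Matches-unfix x≡x₀ h)) (Matches-at x₀k≡0 k<n h)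

    cover₁ : ∀ {c} → c ∈ φ → Matches k x₁ c → c ∈ filter (∁? positive?) L
    cover₁ c∈φ h = ∈-filter⁺ (∁? positive?) (cover c∈φ (Matches-unfix x≡x₁ h))
      (λ ck≡true → case trans (sym ck≡true) (Matches-at x₁k≡1 k<n h) of λ ())

    both : Visited (suc k) x (length L) s
    both
      with s₁ , p₁ , N₁ , out₁ ← goDown N k<n ans
      with visited {s₂} p₂ N₂ sound₂ keeps₂ complete₂ ← ih x₀ s₁ N₁ (filter positive? L) cover₀
      with s₃ , p₃ , N₃ , out₃ ← goAcross N₂ k<n x₀k≡0
      with visited {s₄} p₄ N₄ sound₄ keeps₄ complete₄ ← ih x₁ s₃ N₃ (filter (∁? positive?) L) cover₁
      with s₅ , p₅ , node r₀ r₁ r₂ S , out₅ ← goUp N₄ k<n x₁k≡1 =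
      visited
        -- The clause returned by the oracle lies in `L`, so `L` is not empty and pays for the
        -- branching.
        (⟶-weaken (visitTime-split k (length-filter-∁ positive? L) (∈-length (cover (∈-lookup j) matchⱼ)))
          (⟶-trans p₁ (⟶-trans p₂ (⟶-trans p₃ (⟶-trans p₄ p₅)))))
        (node r₀ r₁ r₂ (Subcube-cong (λ i k<i → sym (x≡x₁ i k<i)) S))
        (λ h → sound₄ (sound₂ (h ∘ subst (_ ∈_) out₁) ∘ subst (_ ∈_) out₃) ∘ subst (_ ∈_) out₅)
        (s₂⊆s₅ ∘ keeps₂ ∘ subst (_ ∈_) (sym out₁))
        complete′
      where
      s₂⊆s₅ : output s₂ ⊆ output s₅
      s₂⊆s₅ = subst (_ ∈_) (sym out₅) ∘ keeps₄ ∘ subst (_ ∈_) (sym out₃)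

      complete′ : ∀ {c} → c ∈ φ → Matches (suc k) x c → c ∈ output s₅
      -- `wide` rules out the third case, a clause without the variable `k`.
      complete′ {c} c∈φ h with lookup c (fromℕ< k<n) in ck | All.lookup wide c∈φ (fromℕ< k<n)
      ... | just true  | _ = s₂⊆s₅ (complete₂ c∈φ (Matches-fix x≡x₀ x₀k≡0 k<n ck h))
      ... | just false | _ = subst (_ ∈_) (sym out₅) (complete₄ c∈φ (Matches-fix x≡x₁ x₁k≡1 k<n ck h))

  visitMiss : Node 1 k x s → answer (queries s) (probs s) ≡ nothing →
              (∀ {c} → c ∈ φ → ¬ Matches k x c) → ∀ {ℓ} → Visited k x ℓ s
  visitMiss {k} N ans none {ℓ} with _ , p , N′ , out ← miss N ans =
    visited (⟶-weaken (≤-trans (m≤m+n 11 11) (m≤m+n 22 ((88 * k + 12 * n) * ℓ))) p) N′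
      (λ h → h ∘ subst (_ ∈_) out) (subst (_ ∈_) (sym out))
      (λ c∈φ h → contradiction h (none c∈φ))

  visitPoint : Node 1 0 x s → ∀ {j} → answer (queries s) (probs s) ≡ just j →
               Matches 0 x (List.lookup φ j) → ∀ {ℓ} → 1 ≤ ℓ → Visited 0 x ℓ s
  visitPoint {x} {s} N {j} ans matchⱼ {ℓ} 1≤ℓ with _ , c , p , N′ , out , match ← hit N ans =
    visited (⟶-weaken (+-monoʳ-≤ 22 time≤) p) N′
      (λ h c∈ → sound′ h (subst (_ ∈_) out c∈))
      (λ c∈ → subst (_ ∈_) (sym out) (there c∈))
      (λ c∈φ h → subst (_ ∈_) (sym out) (here (Matches-0-unique h match)))
    where
    -- The clause written and the one returned by the oracle have the same forbidden point, hence
    -- coincide.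
    sound′ : output s ⊆ φ → c ∷ output s ⊆ φ
    sound′ h (here refl) = subst (_∈ φ) (Matches-0-unique matchⱼ match) (∈-lookup j)
    sound′ h (there c∈)  = h c∈

    time≤ : 12 * n ≤ (88 * 0 + 12 * n) * ℓ
    time≤ = ≤-trans (m≤m*n (12 * n) ℓ {{>-nonZero 1≤ℓ}}) (*-monoˡ-≤ ℓ (m≤n+m (12 * n) (88 * 0)))

  visit : ∀ k → k ≤ n → Visitor k
  -- `valid` is abstracted along with the answer, so that splitting on the answer refines its type.
  visit k k≤n x s N L cover with answer (queries s) (probs s) in ans | valid (queries s) (probs s)
  visit k       k≤n x s N L cover | nothing | v = visitMiss N ans (∉-satisfied N v)
  visit zero    k≤n x s N L cover | just j  | v =
    visitPoint N ans (worst-Matches N v) (∈-length (cover (∈-lookup j) (worst-Matches N v)))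
  visit (suc k) k<n x s N L cover | just j  | v =
    visitBranch k<n (visit k (<⇒≤ k<n)) N ans (worst-Matches N v) L cover

  -- Initialisation and the complete run

  record Initialised (j : ℕ) (s : State n) : Set where
    constructor initialised
    field
      {s′}    : State n
      run     : ⟨_,_⟩⇓[_]_ O initialise s (j * 12 + 4) s′
      reg0≡n  : registers s′ 0 ≡ n
      reg1≡n  : registers s′ 1 ≡ n
      output≡ : output s′ ≡ output s
      allFree : Subcube n n (λ _ → 0) (probs s′) (memory s′)

  -- The first `k` variables are already free and `j` remain; none is fixed, so `hi` is `n`. An
  -- iteration takes 4 + 4 + 4 units, the last test 4.
  runInitialise : ∀ j k (s : State n) → j + k ≡ n → registers s 0 ≡ n → registers s 1 ≡ k →
                  Subcube k n (λ _ → 0) (probs s) (memory s) → Initialised j s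
  runInitialise zero k s refl r₀ r₁ S =
    initialised (⇓stop (trans (cong₂ _∸_ r₀ r₁) (n∸n≡0 n))) r₀ r₁ refl S
  runInitialise (suc j) k s j+k≡n r₀ r₁ S
    with k<n ← subst (k <_) j+k≡n (s≤s (m≤n+m k j))
    with initialised d r₀′ r₁′ out S′ ← runInitialise j (suc k) _ (trans (+-suc j k) j+k≡n) r₀
           (trans (cong (_+ 1) r₁) (+-comm k 1))
           (Subcube-free {p = fraction 1 2 (s≤s z≤n)} S k<n (subst (_< n) (sym r₁) k<n) r₁ refl) =
    initialised (⇓loop (reg0∸reg1≢0 {s = s} r₀ r₁ k<n) (⇓⨾ (⇓setProb (subst (_< n) (sym r₁) k<n) (s≤s z≤n)) ⇓≔) d)
      r₀′ r₁′ out S′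

  runLearner : LearnsWithin learner O (42 + 12 * n + 100 * (n * length φ))
  runLearner
    with initialised d r₀ r₁ out S ← runInitialise n 0 (initial n) (+-identityʳ n) refl refl
           record { free = λ _ () ; fixed = λ i n≤i → contradiction (toℕ<n i) (≤⇒≯ n≤i)
                  ; stored = λ _ _ → refl }
    -- The search starts from the whole cube, whose forbidden points are listed by `φ` itself.
    with visited {s₂} p (node r₀′ r₁′ r₂′ _) sound _ complete ←
           visit n ≤-refl (λ _ → 0) _ (node r₀ r₁ refl S) φ (λ c∈φ _ → c∈φ) =
    _ , _ , ⇓⨾ d (⇓⨾ ⇓≔ (resume (⟶-trans p halt) (⇓stop refl))) , time≤ ,
    -- Satisfaction quantifies over all clauses, so mutual inclusion gives equivalence.
    λ y → mk⇔ (All.anti-mono ⊆-output) (All.anti-mono output-⊆)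
    where
    halt = leave-step r₂′ (⇓else (trans (cong₂ _∸_ r₀′ r₁′) (n∸n≡0 n)) ⇓≔)

    ⊆-output : φ ⊆ output s₂
    ⊆-output c∈φ = complete c∈φ (matches λ i n≤i → contradiction (toℕ<n i) (≤⇒≯ n≤i))

    output-⊆ : output s₂ ⊆ φ
    output-⊆ = sound (λ c∈ → case subst (_ ∈_) out c∈ of λ ())

    time≤ : n * 12 + 4 + (2 + (elapsed (⟶-trans p halt) + 2)) ≤ 42 + 12 * n + 100 * (n * length φ)
    time≤ = begin
      n * 12 + 4 + (2 + (elapsed (⟶-trans p halt) + 2))
        ≤⟨ +-monoʳ-≤ (n * 12 + 4) (+-monoʳ-≤ 2 (+-monoˡ-≤ 2 (elapsed≤T (⟶-trans p halt)))) ⟩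
      n * 12 + 4 + (2 + (visitTime n (length φ) + 12 + 2))
        ≡⟨ solve 2 (λ n m → n :* con 12 :+ con 4 :+ (con 2 :+ (con 22 :+ (con 88 :* n :+ con 12 :* n) :* m :+ con 12 :+ con 2))
             := con 42 :+ con 12 :* n :+ con 100 :* (n :* m)) refl n (length φ) ⟩
      42 + 12 * n + 100 * (n * length φ) ∎
      where
      open ≤-Reasoning
      open +-*-Solver

-- Binomial coefficients

1≤nCk : ∀ {n k} → k ≤ n → 1 ≤ n C k
1≤nCk {n}     {zero}  _     = ≤-refl
1≤nCk {suc n} {suc k} k≤n = ≤-trans (1≤nCk (s≤s⁻¹ k≤n))
  (≤-trans (m≤m+n (n C k) (n C suc k)) (≤-reflexive (nCk+nC[k+1]≡[n+1]C[k+1] n k)))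

-- By Pascal's rule, raising n by one adds a coefficient that is at least 1.
n≤nC[1+k] : ∀ {n k} → suc k < n → n ≤ n C suc k
n≤nC[1+k] {suc n} {zero}  _   = ≤-reflexive (sym (nC1≡n (suc n)))
n≤nC[1+k] {suc n} {suc k} k<n = begin
  suc n                          ≡⟨ +-comm 1 n ⟩
  n + 1                          ≤⟨ +-mono-≤ (n≤nC[1+k] (s≤s⁻¹ k<n)) (1≤nCk (s≤s⁻¹ k<n)) ⟩
  n C suc k + n C suc (suc k)    ≡⟨ nCk+nC[k+1]≡[n+1]C[k+1] n (suc k) ⟩
  suc n C suc (suc k)            ∎
  where open ≤-Reasoning

m≤2^m : ∀ m → m ≤ 2 ^ m
m≤2^m zero    = z≤n
m≤2^m (suc m) = begin
  1 + m                 ≤⟨ +-mono-≤ (m^n>0 2 m) (m≤2^m m) ⟩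
  2 ^ m + 2 ^ m         ≡⟨ cong (2 ^ m +_) (+-identityʳ (2 ^ m)) ⟨
  2 ^ suc m             ∎
  where open ≤-Reasoning

-- For m ≥ 2 the index m - 1 lies strictly between 0 and n, so the coefficient is at least n, while
-- m ≤ 2 ^ m. For m = 1 the summand n covers the left side.
n*m≤nC[m∸1]*2^m+n : ∀ n m → m ≤ n → n * m ≤ (n C (m ∸ 1)) * 2 ^ m + n
n*m≤nC[m∸1]*2^m+n n zero          _   = ≤-trans (≤-reflexive (*-zeroʳ n)) z≤n
n*m≤nC[m∸1]*2^m+n n (suc zero)    _   = ≤-trans (≤-reflexive (*-identityʳ n)) (m≤n+m n _)
n*m≤nC[m∸1]*2^m+n n (suc (suc m)) m≤n =
  ≤-trans (*-mono-≤ (n≤nC[1+k] m≤n) (m≤2^m (2 + m))) (m≤m+n _ n)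

proposition1 : ∃[ P ] ∃[ K ] ((n m : ℕ) (φ : Formula n) →
    length φ ≡ m → All IsWide φ → Unique φ → m ≤ n →
    (O : Oracle φ) →
    LearnsWithin P O (K * ((n C (m ∸ 1)) * 2 ^ m + n)))
-- 154 is 42 + 12 + 100: each of 1, n and n m is at most the bound `B`.
proposition1 = learner , 154 , learns
  where
  learns : (n m : ℕ) (φ : Formula n) → length φ ≡ m → All IsWide φ → Unique φ → m ≤ n →
           (O : Oracle φ) → LearnsWithin learner O (154 * ((n C (m ∸ 1)) * 2 ^ m + n))
  learns n m φ refl wide _ m≤n O
    with t , s , run , t≤ , equiv ← Search.runLearner wide O = t , s , run , ≤-trans t≤ time≤ , equiv
    where
    B = (n C (m ∸ 1)) * 2 ^ m + n

    1≤B : 1 ≤ B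
    1≤B = ≤-trans (*-mono-≤ (1≤nCk (≤-trans (m∸n≤m m 1) m≤n)) (m^n>0 2 m)) (m≤m+n _ n)

    time≤ : 42 + 12 * n + 100 * (n * m) ≤ 154 * B
    time≤ = begin
      42 + 12 * n + 100 * (n * m)
        ≤⟨ +-mono-≤ (+-mono-≤ (*-monoʳ-≤ 42 1≤B) (*-monoʳ-≤ 12 (m≤n+m n ((n C (m ∸ 1)) * 2 ^ m))))
                    (*-monoʳ-≤ 100 (n*m≤nC[m∸1]*2^m+n n m m≤n)) ⟩
      42 * B + 12 * B + 100 * B
        ≡⟨ solve 1 (λ b → con 42 :* b :+ con 12 :* b :+ con 100 :* b := con 154 :* b) refl B ⟩
      154 * B ∎
      where
      open ≤-Reasoning
      open +-*-Solver
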